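{- For every $k\in\mathbb{N}$ there exists an instance $\mathcal{I}$ of the Strip Packing Problem in which all rectangles are squares, together with an initial ordering of its squares, such that the bottom-left $k$-local search algorithm started from this ordering returns a packing of height $h_{\text{$k$-BL}}(\mathcal{I}) = 2\cdot h_{\text{OPT}}(\mathcal{I})$.
   Context: Strip Packing Problem: given a strip width $W>0$ and rectangles $r_1,\dots,r_n$ with widths $w_i\le W$ and heights $h_i$, a packing assigns to each $r_i$ a lower-left corner $(x_i,y_i)$; it is feasible if $x_i\ge 0$, $x_i+w_i\le W$, $y_i\ge 0$ and the open rectangles $(x_i,x_i+w_i)\times(y_i,y_i+h_i)$ are pairwise disjoint; no rotations. The height of a packing is $\max_i(y_i+h_i)$ and $h_{\text{OPT}}(\mathcal{I})$ is the minimum height of a feasible packing. Bottom-left algorithm: given an ordering, place the first rectangle at $(0,0)$ and then each subsequent rectangle at a feasible position $(x,y)$ (feasible together with those already placed) with $(y,x)$ lexicographically minimal. Bottom-left $k$-local search algorithm: start with an initial ordering and its bottom-left packing. In each iteration (improvement step), look for a new ordering obtained from the current one by permuting at most $k$ rectangles in the ordering such that the bottom-left packing of the new ordering has strictly smaller height; if one exists, replace the current ordering by it. Stop when no such improvement exists (a local optimum). $h_{\text{$k$-BL}}(\mathcal{I})$ denotes the height of the returned packing.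
   Formalization: Widths, heights and coordinates are rational: the minimum defining the optimal height ranges over packings with rational corners, and the bottom-left rule chooses among rational positions, instead of over the reals. -}

module Defs where

open import Data.Fin.Base as Fin using (Fin)
open import Data.Fin.Permutation using (Permutation′; _⟨$⟩ʳ_)
open import Data.Fin.Subset using (Subset; ∣_∣) renaming (_∉_ to _∉ˢ_)
open import Data.Nat.Base as ℕ using (ℕ; suc)
open import Data.Product.Base using (_×_; _,_; Σ-syntax; ∃-syntax; swap)
open import Data.Product.Relation.Binary.Lex.Strict using (×-Lex)
open import Data.Rational.Base using (ℚ; 0ℚ; _+_; _⊔_; _≤_; _<_)
open import Data.Vec.Base using (foldr₁; tabulate)
open import Function.Base using (_on_)
open import Level using (0ℓ)
open import Relation.Binary.Construct.Closure.ReflexiveTransitive using (Star)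
open import Relation.Binary.Core using (Rel)
open import Relation.Binary.PropositionalEquality.Core using (_≡_; _≢_)
open import Relation.Nullary.Negation.Core using (¬_)
open import Relation.Unary using (Pred; _⊥_)

record Rectangle : Set where
  field
    width height : ℚ
    width>0      : 0ℚ < width
    height>0     : 0ℚ < height

IsSquare : Rectangle → Set
IsSquare r = Rectangle.width r ≡ Rectangle.height r

record Instance (n : ℕ) : Set where
  field
    W       : ℚ
    W>0     : 0ℚ < W
    rect    : Fin n → Rectangle
    width≤W : ∀ i → Rectangle.width (rect i) ≤ W

AllSquares : ∀ {n} → Instance n → Set
AllSquares I = ∀ i → IsSquare (Instance.rect I i)

Point : Set
Point = ℚ × ℚ

-- The open rectangle occupied by r when its lower-left corner is at (x , y).
interior : Rectangle → Point → Pred Point 0ℓ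
interior r (x , y) (a , b) =
  (x < a × a < x + Rectangle.width r) × (y < b × b < y + Rectangle.height r)

-- The lower-left corner of each rectangle.
Packing : ℕ → Set
Packing n = Fin n → Point

module _ {n : ℕ} (I : Instance n) where
  open Instance I

  InStrip : Fin n → Point → Set
  InStrip i (x , y) = 0ℚ ≤ x × x + Rectangle.width (rect i) ≤ W × 0ℚ ≤ y

  Feasible : Packing n → Set
  Feasible p =
    (∀ i → InStrip i (p i)) ×
    (∀ i j → i ≢ j → interior (rect i) (p i) ⊥ interior (rect j) (p j))

  top : Fin n → Point → ℚ
  top i (_ , y) = y + Rectangle.height (rect i)

-- The maximum is only meaningful for a nonempty collection of rectangles.
height : ∀ {m} → Instance (suc m) → Packing (suc m) → ℚ
height I p = foldr₁ _⊔_ (tabulate λ i → top I i (p i))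

IsOptimalHeight : ∀ {m} → Instance (suc m) → ℚ → Set
IsOptimalHeight I h =
  (∃[ p ] Feasible I p × height I p ≡ h) ×
  (∀ p → Feasible I p → h ≤ height I p)

-- σ ⟨$⟩ʳ t is the index of the rectangle that is placed at step t.
Ordering : ℕ → Set
Ordering = Permutation′

-- (x , y) ≤ᴮᴸ (x′ , y′) iff (y , x) is lexicographically at most (y′ , x′).
_≤ᴮᴸ_ : Rel Point 0ℓ
_≤ᴮᴸ_ = ×-Lex _≡_ _<_ _≤_ on swap

module _ {n : ℕ} (I : Instance n) where
  open Instance I

  -- At step t, only the positions given by p to the rectangles placed at
  -- earlier steps matter.
  Placeable : Ordering n → Packing n → Fin n → Point → Set
  Placeable σ p t q =
    InStrip I (σ ⟨$⟩ʳ t) q ×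
    (∀ s → s Fin.< t →
      interior (rect (σ ⟨$⟩ʳ s)) (p (σ ⟨$⟩ʳ s)) ⊥ interior (rect (σ ⟨$⟩ʳ t)) q)

  -- At the first step every position in the strip is placeable, so the
  -- minimal one is (0ℚ , 0ℚ).
  IsBottomLeft : Ordering n → Packing n → Set
  IsBottomLeft σ p = ∀ t →
    Placeable σ p t (p (σ ⟨$⟩ʳ t)) ×
    (∀ q → Placeable σ p t q → p (σ ⟨$⟩ʳ t) ≤ᴮᴸ q)

-- τ arises from σ by rearranging the rectangles at no more than k places.
-- As both are bijections, the same rectangles occupy the places S in σ and τ.
PermutesAtMost : ∀ {n} → ℕ → Rel (Ordering n) 0ℓ
PermutesAtMost {n} k σ τ =
  Σ[ S ∈ Subset n ] ∣ S ∣ ℕ.≤ k × (∀ t → t ∉ˢ S → σ ⟨$⟩ʳ t ≡ τ ⟨$⟩ʳ t)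

module _ {m : ℕ} (I : Instance (suc m)) where

  record State : Set where
    constructor state
    field
      order        : Ordering (suc m)
      packing      : Packing (suc m)
      isBottomLeft : IsBottomLeft I order packing

  open State

  stateHeight : State → ℚ
  stateHeight s = height I (packing s)

  Improvement : ℕ → Rel State 0ℓ
  Improvement k s s′ =
    PermutesAtMost k (order s) (order s′) × stateHeight s′ < stateHeight s

  LocalOptimum : ℕ → Pred State 0ℓ
  LocalOptimum k s = ∀ s′ → ¬ Improvement k s s′

  -- The choice among several improvements is left open, so what is returned
  -- is a relation rather than a function of the initial ordering.
  Returns : ℕ → Ordering (suc m) → State → Set
  Returns k σ s =
    ∃[ p ] Σ[ bl ∈ IsBottomLeft I σ p ]
      Star (Improvement k) (state σ p bl) s × LocalOptimum k s

  -- Some run of the search from σ returns a packing, and every packing that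
  -- a run from σ can return has height h.
  ReturnsHeight : ℕ → Ordering (suc m) → ℚ → Set
  ReturnsHeight k σ h =
    (∃[ s ] Returns k σ s) × (∀ s → Returns k σ s → stateHeight s ≡ h)

{-# OPTIONS --safe #-}
module Submission where

-- Take N = k + 2 squares of side 1, N squares of side A = k + 3 and a strip of
-- width A N + 1. The big squares fit side by side, with the small ones stacked
-- in the remaining column, so the optimum is A. Initially the small squares come
-- first. In any ordering, everything before the last big square has total width
-- at most A (N - 1) + N and is therefore placed contiguously on the floor. If at
-- most k places change, at most k of the first N places hold big squares, so the
-- (k + 1)-th big square is preceded by at least 2 small ones. To the left of it
-- the small squares leave no gap of width A, as there are only N < A of them, and
-- to the right of it at most (A N + 1) - (A (k + 1) + 2) = A - 1 is left. Hence
-- the last big square lies at height at least A, and every such ordering has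
-- height at least 2 A, which the initial one attains.

open import Defs
import Algebra.Properties.CommutativeMonoid.Sum as Sum
open import Data.Bool.Base using (true; false)
open import Data.Empty using (⊥-elim)
open import Data.Fin.Base as Fin using (Fin; zero; suc; toℕ; fromℕ; fromℕ<)
import Data.Fin.Properties as Fin
open import Data.Fin.Permutation as Perm using (_⟨$⟩ʳ_)
open import Data.Fin.Subset using (Subset; ∣_∣) renaming (_∉_ to _∉ˢ_)
open import Data.Integer.Base using (+_)
open import Data.Nat.Base as ℕ using (ℕ; zero; suc; z≤n; s≤s)
open import Data.Nat.Induction using (<-rec)
import Data.Nat.Properties as ℕ
open import Data.Nat.Tactic.RingSolver using (solve-∀)
open import Data.Product.Base using (_×_; _,_; proj₁; proj₂; Σ-syntax; ∃-syntax)
open import Data.Rational.Base using (ℚ; 0ℚ; 1ℚ; _+_; _⊔_; _≤_; _<_; _*_; _/_)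
import Data.Rational.Properties as ℚ
open import Data.Sum.Base using (_⊎_; inj₁; inj₂)
open import Data.Vec.Base using (_∷_; []; there; foldr₁; tabulate)
open import Data.Vec.Functional using (replicate; _++_)
open import Data.Vec.Functional.Properties using (lookup-++-<; lookup-++-≥)
open import Function.Base using (_∘_)
open import Relation.Binary.Construct.Closure.ReflexiveTransitive using (ε; _◅_)
open import Relation.Binary.Definitions using (tri<; tri≈; tri>)
open import Relation.Binary.PropositionalEquality
open import Relation.Nullary using (yes; no; contradiction)
open import Relation.Unary using (_⊥_)

open Sum ℕ.+-0-commutativeMonoid using (sum; sum-permute)

-- Prefix sums

opaque
  -- The bound is a natural number so that it can be compared with `N` or be one past the last
  -- index; beyond `n` the value stays at the full sum.
  prefixSum : ∀ {n} → (Fin n → ℕ) → ℕ → ℕ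
  prefixSum {zero}  f j       = 0
  prefixSum {suc n} f zero    = 0
  prefixSum {suc n} f (suc j) = f zero ℕ.+ prefixSum (f ∘ suc) j

  prefixSum-zero : ∀ {n} (f : Fin n → ℕ) → prefixSum f 0 ≡ 0
  prefixSum-zero {zero}  f = refl
  prefixSum-zero {suc n} f = refl

  prefixSum-suc : ∀ {n} (f : Fin n → ℕ) t →
    prefixSum f (suc (toℕ t)) ≡ prefixSum f (toℕ t) ℕ.+ f t
  prefixSum-suc f zero =
    trans (cong (f zero ℕ.+_) (prefixSum-zero (f ∘ suc))) (ℕ.+-identityʳ _)
  prefixSum-suc f (suc t) =
    trans (cong (f zero ℕ.+_) (prefixSum-suc (f ∘ suc) t)) (sym (ℕ.+-assoc (f zero) _ _))

  prefixSum-mono : ∀ {n} (f : Fin n → ℕ) {i j} → i ℕ.≤ j → prefixSum f i ℕ.≤ prefixSum f j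
  prefixSum-mono {zero}  f i≤j       = z≤n
  prefixSum-mono {suc n} f z≤n       = z≤n
  prefixSum-mono {suc n} f (s≤s i≤j) = ℕ.+-monoʳ-≤ (f zero) (prefixSum-mono (f ∘ suc) i≤j)

  prefixSum-all : ∀ {n} (f : Fin n → ℕ) → prefixSum f n ≡ sum f
  prefixSum-all {zero}  f = refl
  prefixSum-all {suc n} f = cong (f zero ℕ.+_) (prefixSum-all (f ∘ suc))

  prefixSum≤sum : ∀ {n} (f : Fin n → ℕ) (t : Fin n) → prefixSum f (toℕ t) ℕ.≤ sum f
  prefixSum≤sum f t =
    ℕ.≤-trans (prefixSum-mono f (ℕ.<⇒≤ (Fin.toℕ<n t))) (ℕ.≤-reflexive (prefixSum-all f))

  -- Serves twice: with `c = A` it splits a floor position into the shares of small and big squares,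
  -- with `c = 1` it counts places.
  prefixSum-linear : ∀ {n} (f g h : Fin n → ℕ) c → (∀ t → f t ≡ g t ℕ.+ c ℕ.* h t) →
    ∀ j → prefixSum f j ≡ prefixSum g j ℕ.+ c ℕ.* prefixSum h j
  prefixSum-linear {zero}  f g h c eq j       = sym (ℕ.*-zeroʳ c)
  prefixSum-linear {suc n} f g h c eq zero    = sym (ℕ.*-zeroʳ c)
  prefixSum-linear {suc n} f g h c eq (suc j)
    rewrite eq zero | prefixSum-linear (f ∘ suc) (g ∘ suc) (h ∘ suc) c (eq ∘ suc) j =
    regroup (g zero) (h zero) (prefixSum (g ∘ suc) j) (prefixSum (h ∘ suc) j) c
    where
    regroup : ∀ a b x y c → a ℕ.+ c ℕ.* b ℕ.+ (x ℕ.+ c ℕ.* y) ≡ a ℕ.+ x ℕ.+ c ℕ.* (b ℕ.+ y)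
    regroup = solve-∀

  prefixSum-const-1 : ∀ {n} {f : Fin n → ℕ} → (∀ t → f t ≡ 1) →
    ∀ {j} → j ℕ.≤ n → prefixSum f j ≡ j
  prefixSum-const-1 {zero}  f≡1 z≤n       = refl
  prefixSum-const-1 {suc n} f≡1 z≤n       = refl
  prefixSum-const-1 {suc n} f≡1 (s≤s j≤n) = cong₂ ℕ._+_ (f≡1 zero) (prefixSum-const-1 (f≡1 ∘ suc) j≤n)

  -- Prefix sums of an indicator climb from 0 to the total in steps of at most 1, so each value
  -- below the total is left at some `t`. This `t` is the place of the one number `j`, counted from
  -- 0.
  ∃-prefixSum≡ : ∀ {n} (f : Fin n → ℕ) → (∀ t → f t ≡ 0 ⊎ f t ≡ 1) →
    ∀ {j} → j ℕ.< sum f → ∃[ t ] f t ≡ 1 × prefixSum f (toℕ t) ≡ j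
  ∃-prefixSum≡ {suc n} f f≡0∨1 {j} j<sum with f≡0∨1 zero
  ... | inj₁ f₀≡0 =
    let t , ft≡1 , eq = ∃-prefixSum≡ (f ∘ suc) (f≡0∨1 ∘ suc)
                          (subst (λ a → j ℕ.< a ℕ.+ sum (f ∘ suc)) f₀≡0 j<sum)
    in suc t , ft≡1 , cong₂ ℕ._+_ f₀≡0 eq
  ∃-prefixSum≡ {suc n} f f≡0∨1 {zero}  j<sum | inj₂ f₀≡1 = zero , f₀≡1 , refl
  ∃-prefixSum≡ {suc n} f f≡0∨1 {suc j} j<sum | inj₂ f₀≡1 =
    let t , ft≡1 , eq = ∃-prefixSum≡ (f ∘ suc) (f≡0∨1 ∘ suc)
                          (ℕ.s<s⁻¹ (subst (λ a → suc j ℕ.< a ℕ.+ sum (f ∘ suc)) f₀≡1 j<sum))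
    in suc t , ft≡1 , cong₂ ℕ._+_ f₀≡1 eq

  -- Every one counted before `j` sits at its own place of `S`.
  prefixSum≤∣S∣ : ∀ {n} (f : Fin n → ℕ) → (∀ t → f t ≡ 0 ⊎ f t ≡ 1) → (S : Subset n) →
    ∀ j → (∀ t → toℕ t ℕ.< j → t ∉ˢ S → f t ≡ 0) → prefixSum f j ℕ.≤ ∣ S ∣
  prefixSum≤∣S∣ f f≡0∨1 []          j       f≡0 = z≤n
  prefixSum≤∣S∣ f f≡0∨1 (b ∷ S)     zero    f≡0 = z≤n
  prefixSum≤∣S∣ f f≡0∨1 (true ∷ S)  (suc j) f≡0 =
    ℕ.+-mono-≤ f₀≤1 (prefixSum≤∣S∣ (f ∘ suc) (f≡0∨1 ∘ suc) S j
      λ t t<j t∉S → f≡0 (suc t) (s≤s t<j) λ { (there t∈S) → t∉S t∈S })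
    where
    f₀≤1 : f zero ℕ.≤ 1
    f₀≤1 with f≡0∨1 zero
    ... | inj₁ eq = ℕ.≤-trans (ℕ.≤-reflexive eq) z≤n
    ... | inj₂ eq = ℕ.≤-reflexive eq
  prefixSum≤∣S∣ f f≡0∨1 (false ∷ S) (suc j) f≡0 rewrite f≡0 zero (s≤s z≤n) (λ ()) =
    prefixSum≤∣S∣ (f ∘ suc) (f≡0∨1 ∘ suc) S j
      λ t t<j t∉S → f≡0 (suc t) (s≤s t<j) λ { (there t∈S) → t∉S t∈S }

-- The step ranges over `Fin n`, so that it can speak of the square at place `s`, while `P` also
-- makes sense at the end point `n`.
interval-induction : ∀ {n} (P : ℕ → Set) {i j} → i ℕ.≤ j → j ℕ.≤ n → P i →
  (∀ (s : Fin n) → i ℕ.≤ toℕ s → toℕ s ℕ.< j → P (toℕ s) → P (suc (toℕ s))) → P j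
interval-induction {n} P {i} i≤j j≤n Pi step = go (ℕ.≤⇒≤′ i≤j) j≤n step
  where
  go : ∀ {j} → i ℕ.≤′ j → j ℕ.≤ n →
    (∀ (s : Fin n) → i ℕ.≤ toℕ s → toℕ s ℕ.< j → P (toℕ s) → P (suc (toℕ s))) → P j
  go ℕ.≤′-refl _ _ = Pi
  go (ℕ.≤′-step {j} i≤′j) j<n step =
    subst (P ∘ suc) (Fin.toℕ-fromℕ< j<n)
      (step (fromℕ< j<n)
        (subst (i ℕ.≤_) (sym (Fin.toℕ-fromℕ< j<n)) (ℕ.≤′⇒≤ i≤′j))
        (s≤s (ℕ.≤-reflexive (Fin.toℕ-fromℕ< j<n)))
        (subst P (sym (Fin.toℕ-fromℕ< j<n))
          (go i≤′j (ℕ.<⇒≤ j<n) λ s i≤s s<j → step s i≤s (ℕ.m<n⇒m<1+n s<j))))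

-- Natural numbers as rationals

opaque
  ι : ℕ → ℚ
  ι zero    = 0ℚ
  ι (suc n) = 1ℚ + ι n

  ι-zero : ι 0 ≡ 0ℚ
  ι-zero = refl

  ι-homo-+ : ∀ m n → ι (m ℕ.+ n) ≡ ι m + ι n
  ι-homo-+ zero    n = sym (ℚ.+-identityˡ (ι n))
  ι-homo-+ (suc m) n = trans (cong (λ p → 1ℚ + p) (ι-homo-+ m n)) (sym (ℚ.+-assoc 1ℚ (ι m) (ι n)))

  0≤ι : ∀ n → 0ℚ ≤ ι n
  0≤ι zero    = ℚ.≤-refl
  0≤ι (suc n) = subst (_≤ 1ℚ + ι n) (ℚ.+-identityˡ 0ℚ) (ℚ.+-mono-≤ (ℚ.<⇒≤ (ℚ.positive⁻¹ 1ℚ)) (0≤ι n))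

  ι-mono-≤ : ∀ {m n} → m ℕ.≤ n → ι m ≤ ι n
  ι-mono-≤ {n = n} z≤n = 0≤ι n
  ι-mono-≤ (s≤s m≤n)   = ℚ.+-monoʳ-≤ 1ℚ (ι-mono-≤ m≤n)

  ι-mono-< : ∀ {m n} → m ℕ.< n → ι m < ι n
  ι-mono-< {m} m<n = ℚ.<-≤-trans
    (subst (_< 1ℚ + ι m) (ℚ.+-identityˡ (ι m)) (ℚ.+-monoˡ-< (ι m) (ℚ.positive⁻¹ 1ℚ)))
    (ι-mono-≤ m<n)

ι-cancel-≤ : ∀ {m n} → ι m ≤ ι n → m ℕ.≤ n
ι-cancel-≤ {m} {n} le with m ℕ.≤? n
... | yes m≤n = m≤n
... | no m≰n  = contradiction (ℚ.<-≤-trans (ι-mono-< (ℕ.≰⇒> m≰n)) le) (ℚ.<-irrefl refl)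

0<ι : ∀ {n} → 0 ℕ.< n → 0ℚ < ι n
0<ι {n} 0<n = subst (_< ι n) ι-zero (ι-mono-< 0<n)

-- Turns bounds on a rational coordinate into an inequality of natural numbers, where the geometric
-- contradictions are then derived.
ι-squeeze : ∀ {a b c x} → ι a ≤ x → x + ι b ≤ ι c → a ℕ.+ b ℕ.≤ c
ι-squeeze {a} {b} a≤x x+b≤c = ι-cancel-≤
  (subst (_≤ _) (sym (ι-homo-+ a b)) (ℚ.≤-trans (ℚ.+-monoˡ-≤ (ι b) a≤x) x+b≤c))

ι-+-≤ : ∀ {a b c} → a ℕ.+ b ℕ.≤ c → ι a + ι b ≤ ι c
ι-+-≤ {a} {b} {c} le = subst (_≤ ι c) (ι-homo-+ a b) (ι-mono-≤ le)

p<p+q : ∀ p {q} → 0ℚ < q → p < p + q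
p<p+q p {q} 0<q = subst (_< p + q) (ℚ.+-identityʳ p) (ℚ.+-monoʳ-< p 0<q)

-- Disjoint rectangles

-- The larger left end is below the smaller right end, and density gives a point between them.
intervals-meet : ∀ {a b a′ b′} → a < b → a < b′ → a′ < b → a′ < b′ →
  ∃[ c ] (a < c × c < b) × (a′ < c × c < b′)
intervals-meet {a} {b} {a′} {b′} a<b a<b′ a′<b a′<b′ with ℚ.≤-total a a′ | ℚ.≤-total b b′
... | inj₁ a≤a′ | inj₁ b≤b′ = let c , l , r = ℚ.<-dense a′<b in
  c , (ℚ.≤-<-trans a≤a′ l , r) , (l , ℚ.<-≤-trans r b≤b′)
... | inj₁ a≤a′ | inj₂ b′≤b = let c , l , r = ℚ.<-dense a′<b′ in
  c , (ℚ.≤-<-trans a≤a′ l , ℚ.<-≤-trans r b′≤b) , (l , r)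
... | inj₂ a′≤a | inj₁ b≤b′ = let c , l , r = ℚ.<-dense a<b in
  c , (l , r) , (ℚ.≤-<-trans a′≤a l , ℚ.<-≤-trans r b≤b′)
... | inj₂ a′≤a | inj₂ b′≤b = let c , l , r = ℚ.<-dense a<b′ in
  c , (l , ℚ.<-≤-trans r b′≤b) , (ℚ.≤-<-trans a′≤a l , r)

module _ (r r′ : Rectangle) {x y x′ y′ : ℚ} where
  private
    module R  = Rectangle r
    module R′ = Rectangle r′

  left⇒disjoint : x + R.width ≤ x′ → interior r (x , y) ⊥ interior r′ (x′ , y′)
  left⇒disjoint le (((_ , a<x+w) , _) , ((x′<a , _) , _)) =
    ℚ.<-asym (ℚ.<-≤-trans a<x+w le) x′<a

  below⇒disjoint : y + R.height ≤ y′ → interior r (x , y) ⊥ interior r′ (x′ , y′)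
  below⇒disjoint le ((_ , (_ , b<y+h)) , (_ , (y′<b , _))) =
    ℚ.<-asym (ℚ.<-≤-trans b<y+h le) y′<b

  -- The hypotheses on `y` and `y′` make the vertical ranges overlap. If the horizontal ranges
  -- overlapped too, there would be a common interior point.
  disjoint⇒beside : interior r (x , y) ⊥ interior r′ (x′ , y′) →
    y < y′ + R′.height → y′ < y + R.height →
    x + R.width ≤ x′ ⊎ x′ + R′.width ≤ x
  disjoint⇒beside disj y<y′+h′ y′<y+h with x + R.width ℚ.≤? x′ | x′ + R′.width ℚ.≤? x
  ... | yes le | _      = inj₁ le
  ... | no _   | yes le = inj₂ le
  ... | no ≰₁  | no ≰₂  =
    let a , xa , x′a = intervals-meet (p<p+q x R.width>0) (ℚ.≰⇒> ≰₂) (ℚ.≰⇒> ≰₁) (p<p+q x′ R′.width>0)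
        b , yb , y′b = intervals-meet (p<p+q y R.height>0) y<y′+h′ y′<y+h (p<p+q y′ R′.height>0)
    in ⊥-elim (disj {a , b} ((xa , yb) , (x′a , y′b)))

-- The height of a packing

≤-maximum : ∀ {m} (f : Fin (suc m) → ℚ) i → f i ≤ foldr₁ _⊔_ (tabulate f)
≤-maximum {zero}  f zero    = ℚ.≤-refl
≤-maximum {suc m} f zero    = ℚ.p≤p⊔q (f zero) _
≤-maximum {suc m} f (suc i) = ℚ.≤-trans (≤-maximum (f ∘ suc) i) (ℚ.p≤q⊔p (f zero) _)

maximum-≤ : ∀ {m} (f : Fin (suc m) → ℚ) {h} → (∀ i → f i ≤ h) → foldr₁ _⊔_ (tabulate f) ≤ h
maximum-≤ {zero}  f le = le zero
maximum-≤ {suc m} f le = ℚ.⊔-lub (le zero) (maximum-≤ (f ∘ suc) (le ∘ suc))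

-- Makes the bottom-left position unique: a placeable point that is minimal must be the one chosen.
≤ᴮᴸ-antisym : ∀ {p q} → p ≤ᴮᴸ q → q ≤ᴮᴸ p → p ≡ q
≤ᴮᴸ-antisym (inj₁ y<y′)         (inj₁ y′<y)         = contradiction y′<y (ℚ.<-asym y<y′)
≤ᴮᴸ-antisym (inj₁ y<y′)         (inj₂ (y′≡y , _))   = contradiction y<y′ (ℚ.<-irrefl (sym y′≡y))
≤ᴮᴸ-antisym (inj₂ (y≡y′ , _))   (inj₁ y′<y)         = contradiction y′<y (ℚ.<-irrefl (sym y≡y′))
≤ᴮᴸ-antisym (inj₂ (y≡y′ , x≤x′)) (inj₂ (_ , x′≤x)) = cong₂ _,_ (ℚ.≤-antisym x≤x′ x′≤x) y≡y′

-- Squares lying side by side on the floor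

module Squares {n : ℕ} (W : ℕ) (size : Fin n → ℕ)
  (size>0 : ∀ i → 0 ℕ.< size i) (size≤W : ∀ i → size i ℕ.≤ W) (W>0 : 0 ℕ.< W) where

  squares : Instance n
  squares = record
    { W       = ι W
    ; W>0     = 0<ι W>0
    ; rect    = λ i → record
      { width    = ι (size i)
      ; height   = ι (size i)
      ; width>0  = 0<ι (size>0 i)
      ; height>0 = 0<ι (size>0 i)
      }
    ; width≤W = λ i → ι-mono-≤ (size≤W i)
    }

  open Instance squares using (rect)

  module _ (τ : Ordering n) where

    placed : Fin n → ℕ
    placed t = size (τ ⟨$⟩ʳ t)

    floor : Fin n → Point
    floor t = ι (prefixSum placed (toℕ t)) , 0ℚ

    FloorBefore : Packing n → Fin n → Set
    FloorBefore p t = ∀ s → s Fin.< t → p (τ ⟨$⟩ʳ s) ≡ floor s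

    module _ (p : Packing n) {t : Fin n} (flr : FloorBefore p t) where

      -- Square `s` lies on the floor and its top is above `y`, so the vertical ranges of the two
      -- squares overlap and only a horizontal separation is possible.
      placeable⇒beside : ∀ {x y} → Placeable squares τ p t (x , y) →
        ∀ s → s Fin.< t → y < ι (placed s) →
        ι (prefixSum placed (toℕ s) ℕ.+ placed s) ≤ x ⊎
        x + ι (placed t) ≤ ι (prefixSum placed (toℕ s))
      placeable⇒beside {x} {y} ((_ , _ , 0≤y) , disj) s s<t y<s
        with disjoint⇒beside (rect (τ ⟨$⟩ʳ s)) (rect (τ ⟨$⟩ʳ t))
               (subst (λ q → interior (rect (τ ⟨$⟩ʳ s)) q ⊥ interior (rect (τ ⟨$⟩ʳ t)) (x , y))
                      (flr s s<t) (λ {q} → disj s s<t {q}))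
               (ℚ.≤-<-trans 0≤y (p<p+q y (0<ι (size>0 _))))
               (subst (y <_) (sym (ℚ.+-identityˡ _)) y<s)
      ... | inj₁ le = inj₁ (subst (_≤ x) (sym (ι-homo-+ (prefixSum placed (toℕ s)) _)) le)
      ... | inj₂ le = inj₂ le

      -- At height 0 the new square is pushed rightwards past the earlier ones, one at a time: once
      -- `x` has reached the left end of square `s`, the new square cannot lie to the left of `s`.
      floor-minimal : ∀ {q} → Placeable squares τ p t q → floor t ≤ᴮᴸ q
      floor-minimal {x , y} pl@((0≤x , _ , 0≤y) , _) with y ℚ.≤? 0ℚ
      ... | no y≰0  = inj₁ (ℚ.≰⇒> y≰0)
      ... | yes y≤0 = inj₂ (ℚ.≤-antisym 0≤y y≤0 ,
        interval-induction (λ j → ι (prefixSum placed j) ≤ x) z≤n (ℕ.<⇒≤ (Fin.toℕ<n t))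
          (subst (_≤ x) (trans (sym ι-zero) (cong ι (sym (prefixSum-zero placed)))) 0≤x)
          λ s _ s<t ≤x → subst (λ j → ι j ≤ x) (sym (prefixSum-suc placed s)) (step s s<t ≤x))
        where
        step : ∀ s → s Fin.< t → ι (prefixSum placed (toℕ s)) ≤ x →
          ι (prefixSum placed (toℕ s) ℕ.+ placed s) ≤ x
        step s s<t ≤x with placeable⇒beside pl s s<t (ℚ.≤-<-trans y≤0 (0<ι (size>0 _)))
        ... | inj₁ le = le
        ... | inj₂ le = contradiction
          (ℕ.<-≤-trans (ℕ.m<m+n _ (size>0 _)) (ι-squeeze ≤x le)) (ℕ.<-irrefl refl)

      floor-placeable : prefixSum placed (suc (toℕ t)) ℕ.≤ W → Placeable squares τ p t (floor t)
      floor-placeable fits =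
        (0≤ι _ , ι-+-≤ (subst (ℕ._≤ W) (prefixSum-suc placed t) fits) , ℚ.≤-refl) ,
        λ s s<t → subst (λ q → interior (rect (τ ⟨$⟩ʳ s)) q ⊥ interior (rect (τ ⟨$⟩ʳ t)) (floor t))
          (sym (flr s s<t))
          (left⇒disjoint (rect (τ ⟨$⟩ʳ s)) (rect (τ ⟨$⟩ʳ t))
            (ι-+-≤ (subst (ℕ._≤ _) (prefixSum-suc placed s) (prefixSum-mono placed s<t))))

    -- Strong induction on the place: if all earlier squares are on the floor, the next floor
    -- position is both placeable and minimal, hence the one chosen.
    bottomLeft⇒floor : ∀ p → IsBottomLeft squares τ p →
      ∀ t → prefixSum placed (toℕ t) ℕ.≤ W → FloorBefore p t
    bottomLeft⇒floor p bl t fits s s<t = go (toℕ s) s refl (fits′ s<t)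
      where
      fits′ : ∀ {s} → s Fin.< t → prefixSum placed (suc (toℕ s)) ℕ.≤ W
      fits′ s<t = ℕ.≤-trans (prefixSum-mono placed s<t) fits

      go : ∀ j s → toℕ s ≡ j → prefixSum placed (suc (toℕ s)) ℕ.≤ W → p (τ ⟨$⟩ʳ s) ≡ floor s
      go = <-rec _ λ { j rec s refl s-fits →
        let flr : FloorBefore p s
            flr s′ s′<s = rec s′<s s′ refl
              (ℕ.≤-trans (prefixSum-mono placed (ℕ.≤-trans s′<s (ℕ.n≤1+n _))) s-fits)
        in ≤ᴮᴸ-antisym (proj₂ (bl s) _ (floor-placeable p flr s-fits))
                       (floor-minimal p flr (proj₁ (bl s))) }

-- The instance

module Construction (k : ℕ) where

  N A W m : ℕ
  N = suc (suc k)
  A = suc N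
  W = suc (A ℕ.* N)
  -- Chosen so that `suc m` computes to `N + N`, the number of squares.
  m = suc k ℕ.+ N

  opaque
    -- `small` and `big` are indicators. Writing `size` as a linear combination of them reduces
    -- total widths to counts.
    small big size : Fin (suc m) → ℕ
    small  = replicate N 1 ++ replicate N 0
    big    = replicate N 0 ++ replicate N 1
    size i = small i ℕ.+ A ℕ.* big i

    size≡ : ∀ i → size i ≡ small i ℕ.+ A ℕ.* big i
    size≡ _ = refl

    small-< : ∀ i → toℕ i ℕ.< N → small i ≡ 1
    small-< = lookup-++-< (replicate N 1) (replicate N 0)

    small-≥ : ∀ i → N ℕ.≤ toℕ i → small i ≡ 0
    small-≥ = lookup-++-≥ (replicate N 1) (replicate N 0)

    big-< : ∀ i → toℕ i ℕ.< N → big i ≡ 0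
    big-< = lookup-++-< (replicate N 0) (replicate N 1)

    big-≥ : ∀ i → N ℕ.≤ toℕ i → big i ≡ 1
    big-≥ = lookup-++-≥ (replicate N 0) (replicate N 1)

  data Kind (i : Fin (suc m)) : Set where
    isSmall : toℕ i ℕ.< N → small i ≡ 1 → big i ≡ 0 → size i ≡ 1 → Kind i
    isBig   : N ℕ.≤ toℕ i → small i ≡ 0 → big i ≡ 1 → size i ≡ A → Kind i

  kind : ∀ i → Kind i
  kind i with toℕ i ℕ.<? N
  ... | yes i<N = isSmall i<N (small-< i i<N) (big-< i i<N)
    (trans (size≡ i) (trans (cong₂ (λ s b → s ℕ.+ A ℕ.* b) (small-< i i<N) (big-< i i<N))
                            (cong suc (ℕ.*-zeroʳ A))))
  ... | no i≮N = isBig N≤i (small-≥ i N≤i) (big-≥ i N≤i)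
    (trans (size≡ i) (trans (cong₂ (λ s b → s ℕ.+ A ℕ.* b) (small-≥ i N≤i) (big-≥ i N≤i))
                            (ℕ.*-identityʳ A)))
    where N≤i = ℕ.≮⇒≥ i≮N

  big≡0∨1 : ∀ i → big i ≡ 0 ⊎ big i ≡ 1
  big≡0∨1 i with kind i
  ... | isSmall _ _ b≡0 _ = inj₁ b≡0
  ... | isBig _ _ b≡1 _   = inj₂ b≡1

  -- The factor 1 gives the shape that `prefixSum-linear` expects.
  small+big≡1 : ∀ i → small i ℕ.+ 1 ℕ.* big i ≡ 1
  small+big≡1 i with kind i
  ... | isSmall _ s≡1 b≡0 _ = cong₂ (λ s b → s ℕ.+ 1 ℕ.* b) s≡1 b≡0
  ... | isBig _ s≡0 b≡1 _   = cong₂ (λ s b → s ℕ.+ 1 ℕ.* b) s≡0 b≡1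

  big≡1⇒size≡A : ∀ i → big i ≡ 1 → size i ≡ A
  big≡1⇒size≡A i b≡1 with kind i
  ... | isSmall _ _ b≡0 _  = contradiction (trans (sym b≡1) b≡0) λ ()
  ... | isBig _ _ _ size≡A = size≡A

  1≤size : ∀ i → 1 ℕ.≤ size i
  1≤size i with kind i
  ... | isSmall _ _ _ eq = ℕ.≤-reflexive (sym eq)
  ... | isBig _ _ _ eq   = ℕ.≤-trans (s≤s z≤n) (ℕ.≤-reflexive (sym eq))

  size≤A : ∀ i → size i ℕ.≤ A
  size≤A i with kind i
  ... | isSmall _ _ _ eq = ℕ.≤-trans (ℕ.≤-reflexive eq) (s≤s z≤n)
  ... | isBig _ _ _ eq   = ℕ.≤-reflexive eq

  A≤W : A ℕ.≤ W
  A≤W = ℕ.≤-trans (ℕ.m≤m*n A N) (ℕ.n≤1+n _)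

  open Squares W size 1≤size (λ i → ℕ.≤-trans (size≤A i) A≤W) (s≤s z≤n) public
  open Instance squares using (rect)

  -- Truncated subtraction covers both halves at once: the first `N` squares are small and all later
  -- ones big.
  prefixSum-big : ∀ {j} → j ℕ.≤ suc m → prefixSum big j ≡ j ℕ.∸ N
  prefixSum-big j≤ = interval-induction (λ j → prefixSum big j ≡ j ℕ.∸ N) z≤n j≤ (prefixSum-zero big)
    λ s _ _ eq → trans (prefixSum-suc big s) (trans (cong (ℕ._+ big s) eq) (step s))
    where
    step : ∀ s → toℕ s ℕ.∸ N ℕ.+ big s ≡ suc (toℕ s) ℕ.∸ N
    step s with kind s
    ... | isSmall s<N _ b≡0 _ = trans
      (cong₂ ℕ._+_ (ℕ.m≤n⇒m∸n≡0 (ℕ.<⇒≤ s<N)) b≡0) (sym (ℕ.m≤n⇒m∸n≡0 s<N))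
    ... | isBig N≤s _ b≡1 _ = trans
      (trans (cong (toℕ s ℕ.∸ N ℕ.+_) b≡1) (ℕ.+-comm _ 1)) (sym (ℕ.+-∸-assoc 1 N≤s))

  sum-big : sum big ≡ N
  sum-big = trans (sym (prefixSum-all big)) (trans (prefixSum-big ℕ.≤-refl) (ℕ.m+n∸n≡m N N))

  -- Lower bound for orderings with few big squares in front

  module _ (τ : Ordering (suc m)) where

    smallAt bigAt : Fin (suc m) → ℕ
    smallAt t = small (τ ⟨$⟩ʳ t)
    bigAt t   = big (τ ⟨$⟩ʳ t)

    floor-position : ∀ j →
      prefixSum (placed τ) j ≡ prefixSum smallAt j ℕ.+ A ℕ.* prefixSum bigAt j
    floor-position = prefixSum-linear (placed τ) smallAt bigAt A (λ t → size≡ (τ ⟨$⟩ʳ t))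

    smallBefore+bigBefore : ∀ {j} → j ℕ.≤ suc m → prefixSum smallAt j ℕ.+ prefixSum bigAt j ≡ j
    smallBefore+bigBefore {j} j≤ = begin
      prefixSum smallAt j ℕ.+ prefixSum bigAt j
        ≡⟨ cong (prefixSum smallAt j ℕ.+_) (sym (ℕ.*-identityˡ _)) ⟩
      prefixSum smallAt j ℕ.+ 1 ℕ.* prefixSum bigAt j
        ≡⟨ sym (prefixSum-linear (λ _ → 1) smallAt bigAt 1 (λ t → sym (small+big≡1 (τ ⟨$⟩ʳ t))) j) ⟩
      prefixSum {suc m} (λ _ → 1) j
        ≡⟨ prefixSum-const-1 (λ _ → refl) j≤ ⟩
      j ∎
      where open ≡-Reasoning

    sum-bigAt : sum bigAt ≡ N
    sum-bigAt = trans (sym (sum-permute big τ)) sum-big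

    sum-smallAt : sum smallAt ≡ N
    sum-smallAt = ℕ.+-cancelʳ-≡ N _ _ (begin
      sum smallAt ℕ.+ N         ≡⟨ cong (sum smallAt ℕ.+_) (sym sum-bigAt) ⟩
      sum smallAt ℕ.+ sum bigAt
        ≡⟨ sym (cong₂ ℕ._+_ (prefixSum-all smallAt) (prefixSum-all bigAt)) ⟩
      prefixSum smallAt (suc m) ℕ.+ prefixSum bigAt (suc m) ≡⟨ smallBefore+bigBefore ℕ.≤-refl ⟩
      N ℕ.+ N ∎)
      where open ≡-Reasoning

    smallBefore≤N : ∀ t → prefixSum smallAt (toℕ t) ℕ.≤ N
    smallBefore≤N t = ℕ.≤-trans (prefixSum≤sum smallAt t) (ℕ.≤-reflexive sum-smallAt)

    -- All earlier squares are on the floor and have side at most `A`, so everything from level `A`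
    -- upwards is free.
    shelf-placeable : ∀ p {t} → FloorBefore τ p t → Placeable squares τ p t (0ℚ , ι A)
    shelf-placeable p {t} flr =
      (ℚ.≤-refl , subst (_≤ ι W) (sym (ℚ.+-identityˡ _)) (ι-mono-≤ (ℕ.≤-trans (size≤A (τ ⟨$⟩ʳ t)) A≤W)) , 0≤ι A) ,
      λ s s<t → subst (λ q → interior (rect (τ ⟨$⟩ʳ s)) q ⊥ interior (rect (τ ⟨$⟩ʳ t)) (0ℚ , ι A))
        (sym (flr s s<t))
        (below⇒disjoint (rect (τ ⟨$⟩ʳ s)) (rect (τ ⟨$⟩ʳ t))
          (subst (_≤ ι A) (sym (ℚ.+-identityˡ _)) (ι-mono-≤ (size≤A (τ ⟨$⟩ʳ s)))))

    -- `v` is the place of the last big square: `k + 1` of the `k + 2` big squares precede it.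
    module _ {v : Fin (suc m)} (v-big : bigAt v ≡ 1) (bigBefore-v : prefixSum bigAt (toℕ v) ≡ suc k) where

      fits-before-last : prefixSum (placed τ) (toℕ v) ℕ.≤ W
      fits-before-last = begin
        prefixSum (placed τ) (toℕ v)                                       ≡⟨ floor-position (toℕ v) ⟩
        prefixSum smallAt (toℕ v) ℕ.+ A ℕ.* prefixSum bigAt (toℕ v)
          ≡⟨ cong (λ b → prefixSum smallAt (toℕ v) ℕ.+ A ℕ.* b) bigBefore-v ⟩
        prefixSum smallAt (toℕ v) ℕ.+ A ℕ.* suc k
          ≤⟨ ℕ.+-monoˡ-≤ (A ℕ.* suc k) (ℕ.≤-trans (smallBefore≤N v) (ℕ.n≤1+n N)) ⟩
        A ℕ.+ A ℕ.* suc k                                                  ≡⟨ ℕ.*-suc A (suc k) ⟨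
        A ℕ.* N                                                            ≤⟨ ℕ.n≤1+n _ ⟩
        W                                                                  ∎
        where open ℕ.≤-Reasoning

      -- The assumption `y<A` is to be refuted. It makes the last big square overlap vertically with
      -- every earlier big square.
      module _ (few : prefixSum bigAt N ℕ.≤ k) (p : Packing (suc m)) (flr : FloorBefore τ p v)
        {x y : ℚ} (pl : Placeable squares τ p v (x , y)) (y<A : y < ι A) where

        smalls bigs : ℕ → ℕ
        smalls = prefixSum smallAt
        bigs   = prefixSum bigAt

        -- Walking along the floor, the last big square must stay to the right of
        -- every big square passed: the gaps between them are narrower than A.
        -- Once two small squares have been passed this costs a shift by c = 2.
        Beyond : ℕ → ℕ → Set
        Beyond c j = ι (c ℕ.+ A ℕ.* bigs j) ≤ x

        pass-big : ∀ c s → s Fin.< v → bigAt s ≡ 1 → c ℕ.≤ smalls (toℕ s) →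
          Beyond 0 (toℕ s) → Beyond c (suc (toℕ s))
        pass-big c s s<v s-big c≤ beyond
          with placeable⇒beside τ p flr pl s s<v
                 (subst (λ a → y < ι a) (sym (big≡1⇒size≡A _ s-big)) y<A)
        ... | inj₁ le = ℚ.≤-trans (ι-mono-≤ bound) le
          where
          open ℕ.≤-Reasoning
          bound : c ℕ.+ A ℕ.* bigs (suc (toℕ s)) ℕ.≤ prefixSum (placed τ) (toℕ s) ℕ.+ placed τ s
          bound = begin
            c ℕ.+ A ℕ.* bigs (suc (toℕ s))
              ≡⟨ cong (λ b → c ℕ.+ A ℕ.* b) (trans (prefixSum-suc bigAt s) (cong (bigs (toℕ s) ℕ.+_) s-big)) ⟩
            c ℕ.+ A ℕ.* (bigs (toℕ s) ℕ.+ 1)               ≡⟨ regroup c A (bigs (toℕ s)) ⟩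
            c ℕ.+ A ℕ.* bigs (toℕ s) ℕ.+ A                  ≤⟨ ℕ.+-monoˡ-≤ A (ℕ.+-monoˡ-≤ _ c≤) ⟩
            smalls (toℕ s) ℕ.+ A ℕ.* bigs (toℕ s) ℕ.+ A
              ≡⟨ cong₂ ℕ._+_ (sym (floor-position (toℕ s))) (sym (big≡1⇒size≡A _ s-big)) ⟩
            prefixSum (placed τ) (toℕ s) ℕ.+ placed τ s     ∎
            where
            regroup : ∀ c a b → c ℕ.+ a ℕ.* (b ℕ.+ 1) ≡ c ℕ.+ a ℕ.* b ℕ.+ a
            regroup = solve-∀
        -- Lying to the left of `s` while beyond the earlier big squares would require the small
        -- squares before `s` to span a width of at least `A`, but there are at most `N`.
        ... | inj₂ le = contradiction (smallBefore≤N s) (ℕ.<⇒≱ (ℕ.+-cancelˡ-≤ (A ℕ.* bigs (toℕ s)) _ _ (begin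
            A ℕ.* bigs (toℕ s) ℕ.+ A             ≤⟨ ι-squeeze beyond
              (subst (λ a → x + ι a ≤ _) (big≡1⇒size≡A _ v-big) le) ⟩
            prefixSum (placed τ) (toℕ s)          ≡⟨ floor-position (toℕ s) ⟩
            smalls (toℕ s) ℕ.+ A ℕ.* bigs (toℕ s) ≡⟨ ℕ.+-comm (smalls (toℕ s)) _ ⟩
            A ℕ.* bigs (toℕ s) ℕ.+ smalls (toℕ s) ∎)))
          where open ℕ.≤-Reasoning

        -- A small square gives no constraint, since the last big square may lie above it; the bound
        -- survives because the count of big squares does not change.
        pass : ∀ c s → s Fin.< v → c ℕ.≤ smalls (toℕ s) →
          Beyond 0 (toℕ s) → Beyond c (toℕ s) → Beyond c (suc (toℕ s))
        pass c s s<v c≤ beyond₀ beyond with big≡0∨1 (τ ⟨$⟩ʳ s)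
        ... | inj₂ s-big = pass-big c s s<v s-big c≤ beyond₀
        ... | inj₁ s-small = subst (λ b → ι (c ℕ.+ A ℕ.* b) ≤ x)
          (sym (trans (prefixSum-suc bigAt s) (trans (cong (bigs (toℕ s) ℕ.+_) s-small) (ℕ.+-identityʳ _))))
          beyond

        beyond₀ : ∀ {j} → j ℕ.≤ toℕ v → Beyond 0 j
        beyond₀ {j} j≤v = interval-induction (Beyond 0) z≤n (ℕ.≤-trans j≤v (ℕ.<⇒≤ (Fin.toℕ<n v)))
          (subst (_≤ x) (trans (sym ι-zero) (cong ι (sym (trans (cong (A ℕ.*_) (prefixSum-zero bigAt)) (ℕ.*-zeroʳ A))))) (proj₁ (proj₁ pl)))
          λ s _ s<j b → pass 0 s (ℕ.<-≤-trans s<j j≤v) z≤n b b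

        -- `u` is the place of the last big square but one.
        module _ (u : Fin (suc m)) (u-big : bigAt u ≡ 1) (bigBefore-u : bigs (toℕ u) ≡ k) where

          -- Otherwise the first `N` places would hold `k + 1` big squares.
          N≤u : N ℕ.≤ toℕ u
          N≤u = ℕ.≮⇒≥ λ u<N → contradiction few (ℕ.<⇒≱ (begin
            suc k                      ≡⟨ ℕ.+-comm 1 k ⟩
            k ℕ.+ 1                    ≡⟨ cong₂ ℕ._+_ bigBefore-u u-big ⟨
            bigs (toℕ u) ℕ.+ bigAt u   ≡⟨ prefixSum-suc bigAt u ⟨
            bigs (suc (toℕ u))         ≤⟨ prefixSum-mono bigAt u<N ⟩
            bigs N                     ∎))
            where open ℕ.≤-Reasoning

          -- At least `N = k + 2` squares precede `u`, and only `k` of them are big.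
          2≤smallBefore-u : 2 ℕ.≤ smalls (toℕ u)
          2≤smallBefore-u = ℕ.+-cancelʳ-≤ k _ _ (begin
            N                                  ≤⟨ N≤u ⟩
            toℕ u                              ≡⟨ smallBefore+bigBefore (ℕ.<⇒≤ (Fin.toℕ<n u)) ⟨
            smalls (toℕ u) ℕ.+ bigs (toℕ u)    ≡⟨ cong (smalls (toℕ u) ℕ.+_) bigBefore-u ⟩
            smalls (toℕ u) ℕ.+ k               ∎)
            where open ℕ.≤-Reasoning

          u<v : u Fin.< v
          u<v = ℕ.≰⇒> λ v≤u → contradiction
            (subst₂ ℕ._≤_ bigBefore-v bigBefore-u (prefixSum-mono bigAt v≤u)) (ℕ.<⇒≱ ℕ.≤-refl)

          -- Passing `u` itself creates the shift by 2; the walk from there to `v` preserves it.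
          beyond₂ : Beyond 2 (toℕ v)
          beyond₂ = interval-induction (Beyond 2) u<v (ℕ.<⇒≤ (Fin.toℕ<n v))
            (pass-big 2 u u<v u-big 2≤smallBefore-u (beyond₀ (ℕ.<⇒≤ u<v)))
            λ s u<s s<v → pass 2 s s<v
              (ℕ.≤-trans 2≤smallBefore-u (prefixSum-mono smallAt (ℕ.<⇒≤ u<s)))
              (beyond₀ (ℕ.<⇒≤ s<v))

        -- This is the contradiction sought: the left side equals `A * N + 2`, one more than `W`.
        low⇒too-wide : 2 ℕ.+ A ℕ.* suc k ℕ.+ A ℕ.≤ W
        low⇒too-wide =
          let u , u-big , bigBefore-u = ∃-prefixSum≡ bigAt (big≡0∨1 ∘ (τ ⟨$⟩ʳ_))
                (subst (k ℕ.<_) (sym sum-bigAt) (ℕ.m≤n⇒m≤1+n ℕ.≤-refl))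
          in ι-squeeze
            (subst (λ b → ι (2 ℕ.+ A ℕ.* b) ≤ x) bigBefore-v (beyond₂ u u-big bigBefore-u))
            (subst (λ a → x + ι a ≤ ι W) (big≡1⇒size≡A _ v-big) (proj₁ (proj₂ (proj₁ pl))))

      last-big-high : prefixSum bigAt N ℕ.≤ k → ∀ p → FloorBefore τ p v →
        ∀ {q} → Placeable squares τ p v q → ι A ≤ proj₂ q
      last-big-high few p flr {x , y} pl with ι A ℚ.≤? y
      ... | yes A≤y = A≤y
      ... | no A≰y  = contradiction (low⇒too-wide few p flr pl (ℚ.≰⇒> A≰y))
        (ℕ.<⇒≱ (ℕ.≤-reflexive (cong (2 ℕ.+_) (trans (ℕ.*-suc A (suc k)) (ℕ.+-comm A _)))))

    -- The last big square starts at level `A` or higher. The bound applies both to the initial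
    -- ordering and to all its neighbours.
    height≥2A : prefixSum bigAt N ℕ.≤ k → ∀ p → IsBottomLeft squares τ p →
      ι (A ℕ.+ A) ≤ height squares p
    height≥2A few p bl =
      let v , v-big , bigBefore-v = ∃-prefixSum≡ bigAt (big≡0∨1 ∘ (τ ⟨$⟩ʳ_))
            (subst (suc k ℕ.<_) (sym sum-bigAt) ℕ.≤-refl)
          flr = bottomLeft⇒floor τ p bl v (fits-before-last v-big bigBefore-v)
          A≤y = last-big-high v-big bigBefore-v few p flr {p (τ ⟨$⟩ʳ v)} (proj₁ (bl v))
      in ℚ.≤-trans
        (subst₂ _≤_ (sym (ι-homo-+ A A))
          (cong (λ a → proj₂ (p (τ ⟨$⟩ʳ v)) + ι a) (sym (big≡1⇒size≡A _ v-big)))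
          (ℚ.+-monoˡ-≤ (ι A) A≤y))
        (≤-maximum (λ i → top squares i (p i)) (τ ⟨$⟩ʳ v))

  -- The initial ordering and its neighbours

  few-bigs-first : ∀ τ → PermutesAtMost k Perm.id τ → prefixSum (bigAt τ) N ℕ.≤ k
  few-bigs-first τ (S , ∣S∣≤k , agree) = ℕ.≤-trans
    -- Among the first `N` places, one outside `S` keeps its original square, which is small.
    (prefixSum≤∣S∣ (bigAt τ) (big≡0∨1 ∘ (τ ⟨$⟩ʳ_)) S N
      λ t t<N t∉S → trans (cong big (sym (agree t t∉S))) (small-first t t<N))
    ∣S∣≤k
    where
    small-first : ∀ t → toℕ t ℕ.< N → big t ≡ 0
    small-first t t<N with kind t
    ... | isSmall _ _ b≡0 _ = b≡0
    ... | isBig N≤t _ _ _   = contradiction N≤t (ℕ.<⇒≱ t<N)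

  few-id : prefixSum (bigAt Perm.id) N ℕ.≤ k
  few-id = ℕ.≤-trans (ℕ.≤-reflexive (trans (prefixSum-big (ℕ.m≤m+n N N)) (ℕ.n∸n≡0 N))) z≤n

  -- The hypothesis forces `t` to be the last place.
  module _ {t : Fin (suc m)} (m≤t : m ℕ.≤ toℕ t) where

    last-is-big : big t ≡ 1
    last-is-big with kind t
    ... | isSmall t<N _ _ _ = contradiction t<N (ℕ.≤⇒≯ (ℕ.≤-trans (ℕ.m≤n+m N (suc k)) m≤t))
    ... | isBig _ _ b≡1 _   = b≡1

    bigBefore-last : prefixSum big (toℕ t) ≡ suc k
    bigBefore-last = begin
      prefixSum big (toℕ t) ≡⟨ prefixSum-big (ℕ.<⇒≤ (Fin.toℕ<n t)) ⟩
      toℕ t ℕ.∸ N           ≡⟨ cong (ℕ._∸ N) (ℕ.≤-antisym (Fin.toℕ≤pred[n] t) m≤t) ⟩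
      m ℕ.∸ N               ≡⟨ ℕ.m+n∸n≡m (suc k) N ⟩
      suc k                 ∎
      where open ≡-Reasoning

  first-m-fit : prefixSum size m ℕ.≤ W
  first-m-fit = subst (λ j → prefixSum size j ℕ.≤ W) (Fin.toℕ-fromℕ m)
    (fits-before-last Perm.id (last-is-big m≤last) (bigBefore-last m≤last))
    where
    m≤last : m ℕ.≤ toℕ (fromℕ m)
    m≤last = ℕ.≤-reflexive (sym (Fin.toℕ-fromℕ m))

  initial : Packing (suc m)
  initial t with toℕ t ℕ.<? m
  ... | yes _ = floor Perm.id t
  ... | no _  = 0ℚ , ι A

  initial-floor : ∀ t → toℕ t ℕ.< m → initial t ≡ floor Perm.id t
  initial-floor t t<m with toℕ t ℕ.<? m
  ... | yes _   = refl
  ... | no  t≮m = contradiction t<m t≮m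

  initial-floorBefore : ∀ t → FloorBefore Perm.id initial t
  initial-floorBefore t s s<t = initial-floor s (ℕ.<-≤-trans s<t (Fin.toℕ≤pred[n] t))

  initial-bottomLeft : IsBottomLeft squares Perm.id initial
  initial-bottomLeft t with toℕ t ℕ.<? m
  ... | yes t<m =
    floor-placeable Perm.id initial {t} flr (ℕ.≤-trans (prefixSum-mono size t<m) first-m-fit) ,
    λ q → floor-minimal Perm.id initial {t} flr
    where flr = initial-floorBefore t
  ... | no t≮m = shelf-placeable Perm.id initial {t} flr , minimal
    where
    flr = initial-floorBefore t
    m≤t = ℕ.≮⇒≥ t≮m
    minimal : ∀ q → Placeable squares Perm.id initial t q → (0ℚ , ι A) ≤ᴮᴸ q
    minimal q@(x , y) pl with y ℚ.≤? ι A
    -- `last-big-high` excludes `y` below `A`, so apart from higher points only `y` equal to `A`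
    -- remains, where 0 is the least abscissa.
    ... | no y≰A  = inj₁ (ℚ.≰⇒> y≰A)
    ... | yes y≤A = inj₂
      (ℚ.≤-antisym
         (last-big-high Perm.id {t} (last-is-big m≤t) (bigBefore-last m≤t) few-id initial flr pl) y≤A ,
       proj₁ (proj₁ pl))

  -- The shelf corner `(0ℚ , ι A)` is placeable at every step, so no square is put above level `A`.
  height≤2A : ∀ p → IsBottomLeft squares Perm.id p → height squares p ≤ ι (A ℕ.+ A)
  height≤2A p bl = maximum-≤ (λ i → top squares i (p i)) λ t →
    subst (top squares t (p t) ≤_) (sym (ι-homo-+ A A))
      (ℚ.+-mono-≤ (low t) (ι-mono-≤ (size≤A t)))
    where
    flr : ∀ t → FloorBefore Perm.id p t
    flr t = bottomLeft⇒floor Perm.id p bl t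
      (ℕ.≤-trans (prefixSum-mono size (Fin.toℕ≤pred[n] t)) first-m-fit)

    low : ∀ t → proj₂ (p t) ≤ ι A
    low t with proj₂ (bl t) (0ℚ , ι A) (shelf-placeable Perm.id p (flr t))
    ... | inj₁ y<A       = ℚ.<⇒≤ y<A
    ... | inj₂ (y≡A , _) = ℚ.≤-reflexive y≡A

  height≡2A : ∀ p → IsBottomLeft squares Perm.id p → height squares p ≡ ι (A ℕ.+ A)
  height≡2A p bl = ℚ.≤-antisym (height≤2A p bl) (height≥2A Perm.id few-id p bl)

  -- The optimal packing

  optimal : Packing (suc m)
  optimal i with toℕ i ℕ.<? N
  ... | yes _ = ι (A ℕ.* N) , ι (toℕ i)
  ... | no _  = ι (A ℕ.* (toℕ i ℕ.∸ N)) , 0ℚ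

  optimal-small : ∀ i → toℕ i ℕ.< N → optimal i ≡ (ι (A ℕ.* N) , ι (toℕ i))
  optimal-small i i<N with toℕ i ℕ.<? N
  ... | yes _   = refl
  ... | no  i≮N = contradiction i<N i≮N

  optimal-big : ∀ i → N ℕ.≤ toℕ i → optimal i ≡ (ι (A ℕ.* (toℕ i ℕ.∸ N)) , 0ℚ)
  optimal-big i N≤i with toℕ i ℕ.<? N
  ... | yes i<N = contradiction N≤i (ℕ.<⇒≱ i<N)
  ... | no  _   = refl

  column-fits : ∀ {i a b} → size i ≡ A → a ℕ.< b → ι (A ℕ.* a) + ι (size i) ≤ ι (A ℕ.* b)
  column-fits {i} {a} {b} size≡A a<b = ι-+-≤ (begin
    A ℕ.* a ℕ.+ size i ≡⟨ cong (A ℕ.* a ℕ.+_) size≡A ⟩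
    A ℕ.* a ℕ.+ A      ≡⟨ ℕ.+-comm (A ℕ.* a) A ⟩
    A ℕ.+ A ℕ.* a      ≡⟨ ℕ.*-suc A a ⟨
    A ℕ.* suc a        ≤⟨ ℕ.*-monoʳ-≤ A a<b ⟩
    A ℕ.* b            ∎)
    where open ℕ.≤-Reasoning

  column<N : ∀ {i : Fin (suc m)} → N ℕ.≤ toℕ i → toℕ i ℕ.∸ N ℕ.< N
  column<N {i} N≤i = subst (toℕ i ℕ.∸ N ℕ.<_) (ℕ.m+n∸n≡m N N) (ℕ.∸-monoˡ-< (Fin.toℕ<n i) N≤i)

  optimal-inStrip : ∀ i → InStrip squares i (optimal i)
  optimal-inStrip i with kind i
  ... | isSmall i<N _ _ size≡1 rewrite optimal-small i i<N =
    0≤ι _ , ι-+-≤ (ℕ.≤-reflexive (trans (cong (A ℕ.* N ℕ.+_) size≡1) (ℕ.+-comm _ 1))) , 0≤ι _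
  ... | isBig N≤i _ _ size≡A rewrite optimal-big i N≤i =
    0≤ι _ , ℚ.≤-trans (column-fits {i} size≡A (column<N {i} N≤i)) (ι-mono-≤ (ℕ.n≤1+n _)) , ℚ.≤-refl

  optimal-disjoint-< : ∀ i j → i Fin.< j →
    interior (rect i) (optimal i) ⊥ interior (rect j) (optimal j)
  optimal-disjoint-< i j i<j with kind i | kind j
  ... | isSmall i<N _ _ size≡1 | isSmall j<N _ _ _
    rewrite optimal-small i i<N | optimal-small j j<N =
    below⇒disjoint (rect i) (rect j)
      (ι-+-≤ (subst (ℕ._≤ toℕ j) (sym (trans (cong (toℕ i ℕ.+_) size≡1) (ℕ.+-comm _ 1))) i<j))
  ... | isSmall i<N _ _ _ | isBig N≤j _ _ size≡A
    rewrite optimal-small i i<N | optimal-big j N≤j =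
    -- The roles are swapped: the big square `j` stands to the left of the column of small squares.
    λ (P , Q) → left⇒disjoint (rect j) (rect i) (column-fits {j} size≡A (column<N {j} N≤j)) (Q , P)
  ... | isBig N≤i _ _ _ | isSmall j<N _ _ _ =
    contradiction (ℕ.<-trans i<j j<N) (ℕ.≤⇒≯ N≤i)
  ... | isBig N≤i _ _ size≡A | isBig N≤j _ _ _
    rewrite optimal-big i N≤i | optimal-big j N≤j =
    left⇒disjoint (rect i) (rect j) (column-fits {i} size≡A (ℕ.∸-monoˡ-< i<j N≤i))

  optimal-feasible : Feasible squares optimal
  optimal-feasible = optimal-inStrip , disjoint
    where
    disjoint : ∀ i j → i ≢ j → interior (rect i) (optimal i) ⊥ interior (rect j) (optimal j)
    disjoint i j i≢j with Fin.<-cmp i j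
    ... | tri< i<j _ _ = optimal-disjoint-< i j i<j
    ... | tri≈ _ i≡j _ = contradiction i≡j i≢j
    ... | tri> _ _ j<i = λ (P , Q) → optimal-disjoint-< j i j<i (Q , P)

  optimal-height≤A : height squares optimal ≤ ι A
  optimal-height≤A = maximum-≤ (λ i → top squares i (optimal i)) bound
    where
    bound : ∀ i → top squares i (optimal i) ≤ ι A
    bound i with kind i
    ... | isSmall i<N _ _ size≡1 rewrite optimal-small i i<N =
      ι-+-≤ (ℕ.≤-trans (ℕ.≤-reflexive (trans (cong (toℕ i ℕ.+_) size≡1) (ℕ.+-comm _ 1)))
                       (ℕ.m≤n⇒m≤1+n i<N))
    ... | isBig N≤i _ _ size≡A rewrite optimal-big i N≤i =
      ℚ.≤-reflexive (trans (ℚ.+-identityˡ _) (cong ι size≡A))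

  -- A single big square already reaches level `A`.
  height≥A : ∀ p → Feasible squares p → ι A ≤ height squares p
  height≥A p (inStrip , _) = ℚ.≤-trans
    (subst₂ _≤_ (ℚ.+-identityˡ (ι A)) (cong (λ a → proj₂ (p v) + ι a) (sym (big≡1⇒size≡A v v-big)))
      (ℚ.+-monoˡ-≤ (ι A) (proj₂ (proj₂ (inStrip v)))))
    (≤-maximum (λ i → top squares i (p i)) v)
    where
    v = fromℕ m
    v-big = last-is-big {v} (ℕ.≤-reflexive (sym (Fin.toℕ-fromℕ m)))

  optimalHeight : IsOptimalHeight squares (ι A)
  optimalHeight =
    (optimal , optimal-feasible , ℚ.≤-antisym optimal-height≤A (height≥A optimal optimal-feasible)) ,
    height≥A

  -- The local search

  no-improvement : ∀ p (bl : IsBottomLeft squares Perm.id p) →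
    LocalOptimum squares k (state Perm.id p bl)
  no-improvement p bl (state τ p′ bl′) (perm , lt) = ℚ.<-irrefl refl
    (ℚ.<-≤-trans lt (ℚ.≤-trans (ℚ.≤-reflexive (height≡2A p bl)) (height≥2A τ (few-bigs-first τ perm) p′ bl′)))

  double : ι (A ℕ.+ A) ≡ (+ 2 / 1) * ι A
  double = begin
    ι (A ℕ.+ A)           ≡⟨ ι-homo-+ A A ⟩
    ι A + ι A             ≡⟨ sym (cong₂ _+_ (ℚ.*-identityˡ (ι A)) (ℚ.*-identityˡ (ι A))) ⟩
    1ℚ * ι A + 1ℚ * ι A   ≡⟨ sym (ℚ.*-distribʳ-+ (ι A) 1ℚ 1ℚ) ⟩
    -- `1ℚ + 1ℚ` computes to `+ 2 / 1`.
    (1ℚ + 1ℚ) * ι A       ∎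
    where open ≡-Reasoning

  returnsHeight : ReturnsHeight squares k Perm.id ((+ 2 / 1) * ι A)
  returnsHeight =
    (state Perm.id initial initial-bottomLeft ,
      initial , initial-bottomLeft , ε , no-improvement initial initial-bottomLeft) ,
    -- Only the empty run is possible: a first step would improve on a local optimum.
    λ { _ (p , bl , ε , _)        → trans (height≡2A p bl) double
      ; _ (p , bl , _◅_ {j = s′} step _ , _) → ⊥-elim (no-improvement p bl s′ step) }

theorem5 : ∀ (k : ℕ) →
    ∃[ m ] Σ[ I ∈ Instance (suc m) ] AllSquares I ×
    (Σ[ σ ∈ Ordering (suc m) ] Σ[ hOPT ∈ ℚ ]
    IsOptimalHeight I hOPT × ReturnsHeight I k σ ((+ 2 / 1) * hOPT))
theorem5 k = m , squares , (λ _ → refl) , Perm.id , ι A , optimalHeight , returnsHeight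
  where open Construction k
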